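{- Let $m\ge2$. A regular $(n,m,k,\lambda)$-EDF forms an $(n,m,K=(k,k,\dots,k),a=mk,\lambda)$-SWEDF.
   Context: Let $G$ be an additive Abelian group of order $n$ with identity $0$. For multi-sets $B_1,B_2$ of elements of $G$, $D(B_1,B_2)$ is the multi-set $\{x-y : x\in B_1,\ y\in B_2\}$; $c\boxtimes B$ is the multi-set in which each element of $B$ is repeated $c$ times; unions are multi-set unions. Let $\mathcal{B}=\{B_i : 1\le i\le m\}$ be a family of pairwise disjoint nonempty subsets of $G$ with $k_i=|B_i|$. $\mathcal{B}$ is an external difference family (EDF) if $\bigcup_{1\le i\ne j\le m}D(B_i,B_j)=\lambda\boxtimes(G\setminus\{0\})$; it is a regular $(n,m,k,\lambda)$-EDF if moreover $k_1=\dots=k_m=k$. With $K=(k_1,\dots,k_m)$, $a=\sum_i k_i$, $\widetilde{k}=\mathrm{lcm}(k_1,\dots,k_m)$ and $\widetilde{B}_i=\frac{\widetilde{k}}{k_i}\boxtimes B_i$, $\mathcal{B}$ is an $(n,m,K,a,\lambda)$-SWEDF (standard weighted external difference family), $\lambda$ a positive integer, if $\bigcup_{1\le i\ne j\le m}D(B_i,\widetilde{B}_j)=\lambda\boxtimes(G\setminus\{0\})$. -}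

module Defs where

open import Algebra.Bundles using (AbelianGroup)
open import Data.Fin.Base using (Fin)
import Data.Fin.Properties as Fin
open import Data.List.Base
  using (List; []; _∷_; length; map; filter; replicate; concatMap; allFin;
         cartesianProduct; cartesianProductWith)
import Data.List.Membership.Setoid as Membership
import Data.List.Relation.Binary.Disjoint.Setoid as Disjointness
import Data.List.Relation.Binary.Permutation.Setoid as Permutation
import Data.List.Relation.Unary.Unique.Setoid as Uniqueness
open import Data.Nat.Base using (ℕ; NonZero; _+_; _/_; _<_)
open import Data.Nat.LCM using (lcm)
open import Data.Product.Base using (_×_; _,_; ∃)
open import Data.Vec.Functional using (Vector; foldr)
open import Function.Bundles using (Inverse)
open import Function.Properties.Inverse using (Inverse⇒Injection)
open import Level using (Level; _⊔_)
open import Relation.Binary.Definitions using (Decidable)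
open import Relation.Binary.PropositionalEquality.Core using (_≡_; _≢_)
import Relation.Binary.PropositionalEquality.Properties as ≡
open import Relation.Nullary.Decidable using (¬?; via-injection)

private
  variable
    a c ℓ : Level
    A : Set a

-- Multi-sets are lists up to the setoid permutation relation.

infixr 7 _⊠_

_⊠_ : ℕ → List A → List A
c ⊠ B = concatMap (replicate c) B

⋃[i≢j] : (m : ℕ) → (Fin m → Fin m → List A) → List A
⋃[i≢j] m f =
  concatMap (λ (i , j) → f i j)
    (filter (λ (i , j) → ¬? (i Fin.≟ j)) (cartesianProduct (allFin m) (allFin m)))

HasOrder : AbelianGroup c ℓ → ℕ → Set (c ⊔ ℓ)
HasOrder G n = Inverse (AbelianGroup.setoid G) (≡.setoid (Fin n))

module _ (G : AbelianGroup c ℓ) where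
  open AbelianGroup G using (Carrier; setoid; _∙_; _⁻¹)
  open Membership setoid using (_∈_)
  open Disjointness setoid using (Disjoint)
  open Uniqueness setoid using (Unique)

  -- A subset is a repetition-free list, so its cardinality is the length.
  record DisjointFamily (m : ℕ) : Set (c ⊔ ℓ) where
    field
      block    : Fin m → List Carrier
      unique   : ∀ i → Unique (block i)
      nonempty : ∀ i → ∃ λ x → x ∈ block i
      disjoint : ∀ {i j} → i ≢ j → Disjoint (block i) (block j)

    size : Vector ℕ m
    size i = length (block i)

    size-nonZero : ∀ i → NonZero (size i)
    size-nonZero i with block i | nonempty i
    ... | []    | _ , ()
    ... | _ ∷ _ | _ = _

    k̃ : ℕ
    k̃ = foldr lcm 1 size

    weightedBlock : Fin m → List Carrier
    weightedBlock i = (k̃ / size i) {{size-nonZero i}} ⊠ block i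

  D : List Carrier → List Carrier → List Carrier
  D = cartesianProductWith (λ x y → x ∙ y ⁻¹)

module _ {G : AbelianGroup c ℓ} {n : ℕ} (order : HasOrder G n) where
  open AbelianGroup G using (Carrier; setoid; _≈_; ε)
  open Permutation setoid using (_↭_)

  _≟_ : Decidable _≈_
  _≟_ = via-injection (Inverse⇒Injection order) Fin._≟_

  G∖0 : List Carrier
  G∖0 = filter (λ x → ¬? (x ≟ ε)) (map (Inverse.from order) (allFin n))

  record IsEDF (m lam : ℕ) (B : DisjointFamily G m) : Set (c ⊔ ℓ) where
    open DisjointFamily B
    field
      differences : ⋃[i≢j] m (λ i j → D G (block i) (block j)) ↭ lam ⊠ G∖0

  record IsRegularEDF (m k lam : ℕ) (B : DisjointFamily G m) : Set (c ⊔ ℓ) where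
    open DisjointFamily B
    field
      isEDF   : IsEDF m lam B
      regular : ∀ i → size i ≡ k

  record IsSWEDF (m : ℕ) (K : Vector ℕ m) (a lam : ℕ)
                 (B : DisjointFamily G m) : Set (c ⊔ ℓ) where
    open DisjointFamily B
    field
      sizes       : ∀ i → size i ≡ K i
      total       : a ≡ foldr _+_ 0 K
      positive    : 0 < lam
      differences : ⋃[i≢j] m (λ i j → D G (block i) (weightedBlock j)) ↭ lam ⊠ G∖0

{-# OPTIONS --safe #-}
module Submission where

-- For blocks of a common size k we have k̃ = k, so every weight k̃ / kᵢ is 1 and the two
-- difference multi-sets coincide. Moreover lam > 0, since for m ≥ 2 the multi-set of
-- external differences is nonempty.

open import Defs
open import Algebra.Bundles using (AbelianGroup)
open import Data.Fin.Base using (Fin; zero; suc)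
import Data.Fin.Properties as Fin
open import Data.List.Base using (List; allFin; cartesianProduct; filter)
import Data.List.Membership.Setoid.Properties as Membership
open import Data.List.Membership.Propositional using (lose)
open import Data.List.Membership.Propositional.Properties
  using (∈-allFin; ∈-cartesianProduct⁺; ∈-filter⁺)
open import Data.List.Properties using (concatMap-cong; concatMap-pure)
import Data.List.Relation.Binary.Permutation.Setoid as Permutation
import Data.List.Relation.Binary.Permutation.Setoid.Properties as Permutationₚ
open import Data.List.Relation.Unary.Any using (Any; satisfied)
import Data.List.Relation.Unary.Any.Properties as Any
open import Data.Nat.Base using (ℕ; NonZero; zero; suc; _+_; _*_; _/_; _≤_; _<_; s≤s; z<s)
open import Data.Nat.Divisibility using (_∣_; 1∣_; ∣-antisym; ∣-reflexive; ∣-trans)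
open import Data.Nat.DivMod using (/-congˡ; n/n≡1)
open import Data.Nat.LCM using (lcm; lcm-least; m∣lcm[m,n]; n∣lcm[m,n])
open import Data.Product.Base using (_,_; proj₂)
open import Data.Vec.Functional using (Vector; foldr; replicate)
open import Level using (Level)
open import Relation.Binary.PropositionalEquality
  using (_≡_; _≢_; _≗_; refl; sym; trans; cong; subst)
open import Relation.Nullary using (¬_; ¬?; contradiction)
open import Relation.Unary using (Pred)

private
  variable
    a p : Level
    A : Set a
    P : Pred A p

1⊠ : (xs : List A) → 1 ⊠ xs ≡ xs
1⊠ = concatMap-pure

-- A witness would lie in some `replicate 0 x`, which is the empty list.
¬Any-0⊠ : (xs : List A) → ¬ Any P (0 ⊠ xs)
¬Any-0⊠ xs p with () ← proj₂ (satisfied (Any.concatMap⁻ _ {xs = xs} p))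

⋃-cong : ∀ m {f g : Fin m → Fin m → List A} → (∀ i j → f i j ≡ g i j) →
         ⋃[i≢j] m f ≡ ⋃[i≢j] m g
⋃-cong m f≗g = concatMap-cong (λ (i , j) → f≗g i j)
  (filter (λ (i , j) → ¬? (i Fin.≟ j)) (cartesianProduct (allFin m) (allFin m)))

-- The pair `(i , j)` survives the filter because `i ≢ j`. Using `Any P` rather than propositional
-- membership lets this apply to membership up to the group's own equality.
⋃⁺ : ∀ {m i j} (f : Fin m → Fin m → List A) → i ≢ j → Any P (f i j) → Any P (⋃[i≢j] m f)
⋃⁺ {i = i} {j} f i≢j p = Any.concatMap⁺ _
  (lose (∈-filter⁺ (λ (i , j) → ¬? (i Fin.≟ j))
                   (∈-cartesianProduct⁺ (∈-allFin i) (∈-allFin j)) i≢j)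
        p)

-- Together with `∣-lcm-foldr`, this is the universal property of the lcm of a finite family. The
-- start value 1 is the lcm of the empty family.
lcm-foldr-least : ∀ {m d} (v : Vector ℕ m) → (∀ i → v i ∣ d) → foldr lcm 1 v ∣ d
lcm-foldr-least {zero}  v v∣d = 1∣ _
lcm-foldr-least {suc m} v v∣d =
  lcm-least (v∣d zero) (lcm-foldr-least (λ i → v (suc i)) (λ i → v∣d (suc i)))

∣-lcm-foldr : ∀ {m} (v : Vector ℕ m) i → v i ∣ foldr lcm 1 v
∣-lcm-foldr v zero    = m∣lcm[m,n] (v zero) _
∣-lcm-foldr v (suc i) =
  ∣-trans (∣-lcm-foldr (λ j → v (suc j)) i) (n∣lcm[m,n] (v zero) _)

sum-replicate : ∀ m k → m * k ≡ foldr _+_ 0 (replicate m k)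
sum-replicate zero    k = refl
sum-replicate (suc m) k = cong (k +_) (sum-replicate m k)

module _ {c ℓ} {G : AbelianGroup c ℓ} {m : ℕ} (B : DisjointFamily G m) where
  open AbelianGroup G using (setoid; ∙-cong; ⁻¹-cong)
  open Permutation setoid using (_↭_)
  open DisjointFamily B

  -- The lcm of equal numbers is their common value, so the weight of block `j` is
  -- `size j / size j`.
  weightedBlock-regular : ∀ {k} → (∀ i → size i ≡ k) → weightedBlock ≗ block
  weightedBlock-regular {k} regular j = trans (cong (_⊠ block j) weight≡1) (1⊠ (block j))
    where
    instance
      size≢0 : NonZero (size j)
      size≢0 = size-nonZero j

    k̃≡size : k̃ ≡ size j
    -- `size j` is a common multiple of all the sizes, being equal to each, and is itself one of
    -- them.
    k̃≡size = ∣-antisym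
      (lcm-foldr-least size (λ i → ∣-reflexive (trans (regular i) (sym (regular j)))))
      (∣-lcm-foldr size j)

    weight≡1 : k̃ / size j ≡ 1
    weight≡1 = trans (/-congˡ k̃≡size) (n/n≡1 (size j))

  -- Two distinct nonempty blocks yield a difference `x - y` in the union, whereas multiplicity 0
  -- would make the right-hand side empty.
  multiplicity-positive : ∀ {i j lam} xs → i ≢ j →
    ⋃[i≢j] m (λ i j → D G (block i) (block j)) ↭ lam ⊠ xs → 0 < lam
  multiplicity-positive {lam = suc _} _ _ _ = z<s
  multiplicity-positive {i} {j} {zero} xs i≢j ⋃↭ with nonempty i | nonempty j
  ... | x , x∈Bᵢ | y , y∈Bⱼ = contradiction
    (Permutationₚ.∈-resp-↭ setoid ⋃↭
      (⋃⁺ (λ i j → D G (block i) (block j)) i≢j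
        (Membership.∈-cartesianProductWith⁺ setoid setoid setoid
          (λ x≈x′ y≈y′ → ∙-cong x≈x′ (⁻¹-cong y≈y′)) x∈Bᵢ y∈Bⱼ)))
    (¬Any-0⊠ xs)

lemma4 : ∀ {c ℓ} (G : AbelianGroup c ℓ) (n : ℕ) (order : HasOrder G n)
    (m k lam : ℕ) → 2 ≤ m → (B : DisjointFamily G m) →
    IsRegularEDF order m k lam B →
    IsSWEDF order m (replicate m k) (m * k) lam B
lemma4 G n order m@(suc (suc _)) k lam (s≤s (s≤s _)) B regularEDF = record
  { sizes       = regular
  ; total       = sum-replicate m k
  -- The bound `2 ≤ m` supplies the two distinct indices 0 and 1.
  ; positive    = multiplicity-positive B {zero} {suc zero} (G∖0 {G = G} order) (λ ()) differences
  -- With all weights 1 the two unions are equal as lists, so the EDF permutation transports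
  -- directly.
  ; differences = subst (_↭ lam ⊠ G∖0 {G = G} order)
      (sym (⋃-cong m (λ i j → cong (D G (block i)) (weightedBlock-regular B regular j))))
      differences
  }
  where
  open AbelianGroup G using (setoid)
  open Permutation setoid using (_↭_)
  open DisjointFamily B using (block)
  open IsRegularEDF regularEDF using (isEDF; regular)
  open IsEDF isEDF using (differences)
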